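{- For every two natural numbers $a,b$ with $3\le a\le b$, there exists a finite, simple, connected graph $G$ such that $\dim_{wt}(G)=a$ and $res_{wt}(G)=b$.
   Context: $d(x,y)$ is the shortest-path distance. A set $W\subseteq V(G)$ is a resolving set if for every two distinct vertices $y,z$ there is $x\in W$ with $d(y,x)\ne d(z,x)$. A set $W$ is a weak total resolving set (WTR-set) if $W$ is resolving and, for every $w\in W$ and every $x\in V(G)\setminus W$, there is $w'\in W\setminus\{w\}$ with $d(x,w')\ne d(w,w')$. $\dim_{wt}(G)$ is the minimum cardinality of a WTR-set. The weak total resolving number $res_{wt}(G)$ is the minimum positive integer $r$ such that every set of $r$ vertices of $G$ is a WTR-set for $G$. -}

module Defs where

open import Data.Fin using (Fin)
open import Data.Fin.Properties using (_≟_; any?; all?)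
open import Data.Fin.Subset using (Subset; _∈_; _∉_; ∣_∣; ⊤)
open import Data.Fin.Subset.Properties using (_∈?_; anySubset?; ∈⊤; ∣p∣≤n; ∣⊤∣≡n)
open import Data.Nat using (ℕ; zero; suc; _≤_; _<_; z≤n; s≤s; z<s; _<?_)
import Data.Nat.Properties as ℕ
open import Data.Product using (∃; ∃-syntax; _×_; _,_)
open import Data.Vec using (Vec; []; _∷_; head; last)
open import Data.Vec.Relation.Unary.AllPairs using (allPairs?)
open import Data.Vec.Relation.Unary.All using ([])
open import Data.Vec.Relation.Unary.Linked using (Linked; [-]; linked?)
open import Data.Vec.Relation.Unary.Unique.Propositional using (Unique; []; _∷_)
open import Level using (0ℓ)
open import Relation.Binary.Core using (Rel)
import Relation.Binary.Definitions as B
open import Relation.Binary.PropositionalEquality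
  using (_≡_; _≢_; refl; sym; trans)
open import Relation.Nullary using (Dec; yes; no; ¬_; ¬?; contradiction; _×-dec_; _→-dec_)
open import Relation.Nullary.Decidable using (map′; decidable-stable)
open import Relation.Unary using (Pred; Decidable)

record Minimum (P : Pred ℕ 0ℓ) : Set where
  field
    value   : ℕ
    holds   : P value
    minimal : ∀ m → P m → value ≤ m

minimum-suc : ∀ {P : Pred ℕ 0ℓ} → ¬ P 0 → Minimum (λ k → P (suc k)) → Minimum P
minimum-suc ¬p₀ M = record
  { value   = suc (Minimum.value M)
  ; holds   = Minimum.holds M
  ; minimal = λ { zero p₀ → contradiction p₀ ¬p₀ ; (suc k) q → s≤s (Minimum.minimal M k q) }
  }

minimum : ∀ {P : Pred ℕ 0ℓ} → Decidable P → ∀ m → P m → Minimum P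
minimum P? zero    p = record { value = 0 ; holds = p ; minimal = λ _ _ → z≤n }
minimum P? (suc m) p with P? 0
... | yes p₀ = record { value = 0 ; holds = p₀ ; minimal = λ _ _ → z≤n }
... | no ¬p₀ = minimum-suc ¬p₀ (minimum (λ k → P? (suc k)) m p)

anyVec? : ∀ {n} k {P : Pred (Vec (Fin n) k) 0ℓ} → Decidable P → Dec (∃ P)
anyVec? zero    P? = map′ ([] ,_) (λ { ([] , p) → p }) (P? [])
anyVec? (suc k) P? =
  map′ (λ { (x , xs , p) → x ∷ xs , p }) (λ { (x ∷ xs , p) → x , xs , p })
       (any? λ x → anyVec? k λ xs → P? (x ∷ xs))

allSubset? : ∀ {n} {P : Pred (Subset n) 0ℓ} → Decidable P → Dec (∀ W → P W)
allSubset? P? =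
  map′ (λ ∄¬P W → decidable-stable (P? W) λ ¬p → ∄¬P (W , ¬p))
       (λ ∀P (W , ¬p) → ¬p (∀P W))
       (¬? (anySubset? λ W → ¬? (P? W)))

record Graph : Set₁ where
  field
    order  : ℕ
    Adj    : Rel (Fin order) 0ℓ
    adj?   : B.Decidable Adj
    symm   : B.Symmetric Adj
    irrefl : B.Irreflexive _≡_ Adj

  Vertex : Set
  Vertex = Fin order

  -- The length of a path is its number of edges.
  IsPath : ∀ {k} → Vertex → Vertex → Vec Vertex (suc k) → Set
  IsPath x y vs = head vs ≡ x × last vs ≡ y × Linked Adj vs × Unique vs

  HasPath : Vertex → Vertex → ℕ → Set
  HasPath x y k = ∃[ vs ] IsPath {k} x y vs

  Connected : Set
  Connected = ∀ x y → ∃ (HasPath x y)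

  hasPath? : ∀ x y → Decidable (HasPath x y)
  hasPath? x y k = anyVec? (suc k) λ vs →
    (head vs ≟ x) ×-dec (last vs ≟ y) ×-dec
    linked? adj? vs ×-dec allPairs? (λ u v → ¬? (u ≟ v)) vs

record ConnectedGraph : Set₁ where
  field
    graph     : Graph
    connected : Graph.Connected graph

  open Graph graph public

  shortest : ∀ x y → Minimum (HasPath x y)
  shortest x y = let (k , p) = connected x y in minimum (hasPath? x y) k p

  d : Vertex → Vertex → ℕ
  d x y = Minimum.value (shortest x y)

  Resolving : Subset order → Set
  Resolving W = ∀ y z → y ≢ z → ∃[ x ] x ∈ W × d y x ≢ d z x

  WTR : Subset order → Set
  WTR W = Resolving W ×
    (∀ w x → w ∈ W → x ∉ W → ∃[ w′ ] (w′ ∈ W × w′ ≢ w) × d x w′ ≢ d w w′)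

  resolving? : Decidable Resolving
  resolving? W = all? λ y → all? λ z → ¬? (y ≟ z) →-dec
    any? λ x → (x ∈? W) ×-dec ¬? (d y x ℕ.≟ d z x)

  wtr? : Decidable WTR
  wtr? W = resolving? W ×-dec
    all? λ w → all? λ x → (w ∈? W) →-dec (¬? (x ∈? W) →-dec
      any? λ w′ → ((w′ ∈? W) ×-dec ¬? (w′ ≟ w)) ×-dec ¬? (d x w′ ℕ.≟ d w w′))

  d-self : ∀ x → d x x ≡ 0
  d-self x = ℕ.n≤0⇒n≡0 (Minimum.minimal (shortest x x) 0
    (x ∷ [] , refl , refl , [-] , [] ∷ []))

  d≡0⇒≡ : ∀ x y → d x y ≡ 0 → x ≡ y
  d≡0⇒≡ x y eq with Minimum.value (shortest x y) | Minimum.holds (shortest x y)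
  d≡0⇒≡ x y refl | .0 | v ∷ [] , refl , refl , _ = refl

  ⊤-wtr : WTR ⊤
  ⊤-wtr =
    (λ y z y≢z → z , ∈⊤ , λ eq → y≢z (d≡0⇒≡ y z (trans eq (d-self z)))) ,
    (λ _ _ _ x∉⊤ → contradiction ∈⊤ x∉⊤)

  HasWTROfSize : ℕ → Set
  HasWTROfSize k = ∃[ W ] ∣ W ∣ ≡ k × WTR W

  dimwtMinimum : Minimum HasWTROfSize
  dimwtMinimum = minimum
    (λ k → anySubset? λ W → (∣ W ∣ ℕ.≟ k) ×-dec wtr? W)
    order (⊤ , ∣⊤∣≡n order , ⊤-wtr)

  dimwt : ℕ
  dimwt = Minimum.value dimwtMinimum

  AllWTROfSize : ℕ → Set
  AllWTROfSize r = 0 < r × (∀ W → ∣ W ∣ ≡ r → WTR W)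

  -- The search bound suc order satisfies AllWTROfSize vacuously; for a nonempty
  -- graph the minimum is at most order, since ⊤ is a WTR-set.
  reswtMinimum : Minimum AllWTROfSize
  reswtMinimum = minimum
    (λ r → (0 <? r) ×-dec allSubset? λ W → (∣ W ∣ ℕ.≟ r) →-dec wtr? W)
    (suc order) (z<s , λ W eq → contradiction (∣p∣≤n W) (ℕ.<⇒≱ (ℕ.≤-reflexive (sym eq))))

  reswt : ℕ
  reswt = Minimum.value reswtMinimum

{-# OPTIONS --safe #-}

-- The witness is the lollipop graph: a clique on a vertices with a path of
-- b − a further vertices hanging from one of them, the junction.  The other
-- a − 1 ≥ 2 clique vertices are twins, so every WTR-set contains all of them;
-- hence only the full vertex set is guaranteed to be WTR, giving res_wt = b.
-- The twins alone do not separate the junction from a twin, whereas the whole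
-- clique is a WTR-set, giving dim_wt = a.

module Submission where

open import Defs
open import Data.Fin using (Fin; zero; suc; toℕ; fromℕ<)
import Data.Fin.Properties as Fin
open import Data.Fin.Subset using (Subset; inside; outside; _∈_; _∉_; ∣_∣; ∁; _⊂_)
open import Data.Fin.Subset.Properties
  using (_∈?_; ∣∁p∣≡n∸∣p∣; ∣p∣≡n⇒p≡⊤; p⊂q⇒∣p∣<∣q∣; x∈p⇒x∉∁p)
open import Data.Nat
  using (ℕ; zero; suc; _+_; _∸_; _⊔_; ∣_-_∣; _≤_; _<_; z≤n; s≤s; z<s; s<s; s≤s⁻¹)
open import Data.Nat.Properties as ℕ
open import Data.Product using (∃-syntax; Σ-syntax; _×_; _,_; proj₂)
open import Data.Sum as Sum using (_⊎_; inj₁; inj₂; [_,_]′)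
open import Data.Vec using (Vec; []; _∷_; here; there)
open import Data.Vec.Relation.Unary.All as All using (All; []; _∷_)
open import Data.Vec.Relation.Unary.AllPairs using ([]; _∷_)
open import Data.Vec.Relation.Unary.Linked using ([-]; _∷_)
open import Function using (_∘_)
open import Relation.Binary.PropositionalEquality
  using (_≡_; _≢_; refl; sym; trans; cong; subst; ≢-sym)
open import Relation.Nullary using (¬_; yes; no; contradiction)

-- Graphs whose shortest-path distance is a prescribed metric.

module GeodesicMetric
  {n : ℕ} (D : Fin n → Fin n → ℕ)
  (D-refl : ∀ x → D x x ≡ 0)
  (D≡0⇒≡ : ∀ x y → D x y ≡ 0 → x ≡ y)
  (D-sym : ∀ x y → D x y ≡ D y x)
  (D-triangle : ∀ x y z → D x z ≤ D x y + D y z)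
  (D-step : ∀ x y k → D x y ≡ suc k → ∃[ z ] D x z ≡ 1 × D z y ≡ k)
  where

  graph : Graph
  graph = record
    { order  = n
    ; Adj    = λ x y → D x y ≡ 1
    ; adj?   = λ x y → D x y ℕ.≟ 1
    ; symm   = λ {x} {y} xy → trans (D-sym y x) xy
    ; irrefl = λ { {x} refl xx → contradiction (trans (sym (D-refl x)) xx) λ () }
    }

  open Graph graph using (Adj; IsPath; HasPath)

  -- The bound on `D v y` is carried along for uniqueness: `x` has value `suc k`, so it differs from
  -- every later vertex.
  geodesic : ∀ k x y → D x y ≡ k →
             ∃[ vs ] IsPath {k} x y vs × All (λ v → D v y ≤ k) vs
  geodesic zero x y eq =
    x ∷ [] , (refl , D≡0⇒≡ x y eq , [-] , [] ∷ []) , ≤-reflexive eq ∷ []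
  geodesic (suc k) x y eq with D-step x y k eq
  ... | z , xz , zy with geodesic k z y zy
  ... | v ∷ vs , (refl , vs-last , linked , unique) , below =
    x ∷ v ∷ vs , (refl , vs-last , xz ∷ linked , All.map x≢ below ∷ unique) ,
    ≤-reflexive eq ∷ All.map m≤n⇒m≤1+n below
    where
    x≢ : ∀ {u} → D u y ≤ k → x ≢ u
    x≢ u≤k refl = <⇒≱ (≤-reflexive (sym eq)) u≤k

  D≤length : ∀ {k} x y (vs : Vec (Fin n) (suc k)) → IsPath x y vs → D x y ≤ k
  D≤length x y (.x ∷ []) (refl , refl , _) = ≤-reflexive (D-refl x)
  D≤length x y (.x ∷ v ∷ vs) (refl , vs-last , xv ∷ linked , _ ∷ unique) =
    ≤-trans (D-triangle x v y)
      (+-mono-≤ (≤-reflexive xv) (D≤length v y (v ∷ vs) (refl , vs-last , linked , unique)))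

  D-path : ∀ x y → HasPath x y (D x y)
  D-path x y = let (vs , path , _) = geodesic (D x y) x y refl in vs , path

  G : ConnectedGraph
  G = record { graph = graph ; connected = λ x y → D x y , D-path x y }

  -- Lets distances be computed from the formula `D` instead of the search defining `d`. A path has
  -- at least `D x y` edges by the triangle inequality, and a geodesic attains this.
  d≡D : ∀ x y → ConnectedGraph.d G x y ≡ D x y
  d≡D x y = ≤-antisym (Minimum.minimal shortest (D x y) (D-path x y))
    (let (vs , path) = Minimum.holds shortest in D≤length x y vs path)
    where shortest = ConnectedGraph.shortest G x y

-- Initial segments, and unit steps between naturals.

firstElements : ∀ n → ℕ → Subset n
firstElements zero    m       = []
firstElements (suc n) zero    = outside ∷ firstElements n zero
firstElements (suc n) (suc m) = inside ∷ firstElements n m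

∣firstElements∣ : ∀ {n m} → m ≤ n → ∣ firstElements n m ∣ ≡ m
∣firstElements∣ {zero}  z≤n       = refl
∣firstElements∣ {suc n} z≤n       = ∣firstElements∣ {n} z≤n
∣firstElements∣ {suc n} (s≤s m≤n) = cong suc (∣firstElements∣ m≤n)

∈-firstElements⁺ : ∀ {n m} {i : Fin n} → toℕ i < m → i ∈ firstElements n m
∈-firstElements⁺ {i = zero}  (s≤s _)   = here
∈-firstElements⁺ {i = suc i} (s≤s i<m) = there (∈-firstElements⁺ i<m)

∈-firstElements⁻ : ∀ {n m} {i : Fin n} → i ∈ firstElements n m → toℕ i < m
∈-firstElements⁻ {m = zero}  {suc i} (there i∈) = contradiction (∈-firstElements⁻ i∈) λ ()
∈-firstElements⁻ {m = suc m} {zero}  _          = z<s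
∈-firstElements⁻ {m = suc m} {suc i} (there i∈) = s<s (∈-firstElements⁻ i∈)

∈∧∉⇒≢ : ∀ {n} {p : Subset n} {x y} → x ∈ p → y ∉ p → x ≢ y
∈∧∉⇒≢ x∈p x∉p refl = x∉p x∈p

-- The step from `m` towards `n` stays strictly below the larger of the two, because the gap is at
-- least 2. Hence `l` will be the height of some vertex.
gap-step : ∀ m n {k} → ∣ m - n ∣ ≡ 2 + k →
           ∃[ l ] (l < m ⊎ l < n) × ∣ m - l ∣ ≡ 1 × ∣ l - n ∣ ≡ suc k
gap-step zero    (suc (suc k)) refl = 1 , inj₂ (s<s z<s) , refl , refl
gap-step (suc m) zero          refl = m , inj₁ ≤-refl , ∣1+m-m∣≡1 m , refl
  where
  ∣1+m-m∣≡1 : ∀ m → ∣ suc m - m ∣ ≡ 1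
  ∣1+m-m∣≡1 zero    = refl
  ∣1+m-m∣≡1 (suc m) = ∣1+m-m∣≡1 m
gap-step (suc m) (suc n)       eq with gap-step m n eq
... | l , l<m⊎l<n , ml , ln = suc l , Sum.map s<s s<s l<m⊎l<n , ml , ln

-- The lollipop metric.

-- The vertices 0, …, c are the twins, c + 1 is the junction, and the remaining
-- ones form the path.
module Lollipop (c n : ℕ) (0<c : 0 < c) (2+c≤n : 2 + c ≤ n) where

  -- The distance to a twin, except that it is 0 at every twin.
  height : Fin n → ℕ
  height x = toℕ x ∸ c

  -- Distinct vertices of equal height are both twins; `1 ⊔_` makes them adjacent.
  D : Fin n → Fin n → ℕ
  D x y with x Fin.≟ y
  ... | yes _ = 0
  ... | no  _ = 1 ⊔ ∣ height x - height y ∣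

  D-refl : ∀ x → D x x ≡ 0
  D-refl x with x Fin.≟ x
  ... | yes _  = refl
  ... | no x≢x = contradiction refl x≢x

  D-≢ : ∀ {x y} → x ≢ y → D x y ≡ 1 ⊔ ∣ height x - height y ∣
  D-≢ {x} {y} x≢y with x Fin.≟ y
  ... | yes x≡y = contradiction x≡y x≢y
  ... | no  _   = refl

  D-height : ∀ {x y} → height x ≢ height y → D x y ≡ ∣ height x - height y ∣
  D-height hx≢hy = trans (D-≢ (hx≢hy ∘ cong height))
    (m≤n⇒m⊔n≡n (n≢0⇒n>0 (hx≢hy ∘ ∣m-n∣≡0⇒m≡n)))

  0<D : ∀ {x y} → x ≢ y → 0 < D x y
  0<D {x} {y} x≢y rewrite D-≢ x≢y = m≤m⊔n 1 ∣ height x - height y ∣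

  ∣height-height∣≤D : ∀ x y → ∣ height x - height y ∣ ≤ D x y
  ∣height-height∣≤D x y with x Fin.≟ y
  ... | yes refl = ≤-reflexive (∣n-n∣≡0 (height x))
  ... | no  _    = m≤n⊔m 1 _

  D≡0⇒≡ : ∀ x y → D x y ≡ 0 → x ≡ y
  D≡0⇒≡ x y eq with x Fin.≟ y
  ... | yes x≡y = x≡y
  ... | no  x≢y = contradiction (≤-trans (m≤m⊔n 1 ∣ height x - height y ∣) (≤-reflexive eq)) λ ()

  D-sym : ∀ x y → D x y ≡ D y x
  D-sym x y with x Fin.≟ y
  ... | yes refl = sym (D-refl x)
  ... | no  x≢y  = trans (cong (1 ⊔_) (∣-∣-comm (height x) (height y))) (sym (D-≢ (≢-sym x≢y)))

  D-triangle : ∀ x y z → D x z ≤ D x y + D y z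
  D-triangle x y z with x Fin.≟ z
  ... | yes _  = z≤n
  ... | no x≢z = ⊔-lub one (≤-trans (∣-∣-triangle (height x) (height y) (height z))
                   (+-mono-≤ (∣height-height∣≤D x y) (∣height-height∣≤D y z)))
    where
    one : 1 ≤ D x y + D y z
    one with x Fin.≟ y
    ... | yes refl = 0<D x≢z
    ... | no  _    = m≤n⇒m≤n+o (D y z) (m≤m⊔n 1 ∣ height x - height y ∣)

  atHeight : ∀ m → m + c < n → ∃[ z ] height z ≡ m
  atHeight m m+c<n = fromℕ< m+c<n , trans (cong (_∸ c) (Fin.toℕ-fromℕ< m+c<n)) (m+n∸n≡m m c)

  belowHeight : ∀ {m} y → m < height y → ∃[ z ] height z ≡ m
  belowHeight {m} y m<hy = atHeight m (<-trans (≰⇒> toℕy≰m+c) (Fin.toℕ<n y))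
    where
    toℕy≰m+c : ¬ toℕ y ≤ m + c
    toℕy≰m+c y≤ = <⇒≱ m<hy (m≤n+o⇒m∸n≤o (toℕ y) c (≤-trans y≤ (≤-reflexive (+-comm m c))))

  gap⇒D : ∀ {x y k} → ∣ height x - height y ∣ ≡ suc k → D x y ≡ suc k
  gap⇒D gap = trans (D-height λ hx≡hy → 0≢1+n (trans (sym (m≡n⇒∣m-n∣≡0 hx≡hy)) gap)) gap

  D⇒gap : ∀ {x y k} → D x y ≡ 2 + k → ∣ height x - height y ∣ ≡ 2 + k
  D⇒gap {x} {y} eq with x Fin.≟ y
  ... | no _ with ∣ height x - height y ∣
  ... | suc _ = eq

  D-step : ∀ x y k → D x y ≡ suc k → ∃[ z ] D x z ≡ 1 × D z y ≡ k
  D-step x y zero    eq = y , eq , D-refl y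
  D-step x y (suc k) eq with gap-step (height x) (height y) (D⇒gap eq)
  ... | m , m<hx⊎m<hy , xm , my with [ belowHeight x , belowHeight y ]′ m<hx⊎m<hy
  ... | z , refl = z , gap⇒D xm , gap⇒D my

  -- Lower bound: what every WTR-set contains.

  open GeodesicMetric D D-refl D≡0⇒≡ D-sym D-triangle D-step public using (G; d≡D)
  open ConnectedGraph G using (d; WTR; Resolving; dimwt; reswt; dimwtMinimum; reswtMinimum; ⊤-wtr)

  0<n : 0 < n
  0<n = <-≤-trans z<s 2+c≤n

  c<n : c < n
  c<n = <⇒≤ 2+c≤n

  twin₀ twin₁ junction : Fin n
  twin₀    = fromℕ< 0<n
  twin₁    = fromℕ< c<n
  junction = fromℕ< 2+c≤n

  twin₀≢twin₁ : twin₀ ≢ twin₁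
  twin₀≢twin₁ eq = <⇒≢ 0<c (Fin.fromℕ<-injective 0 c 0<n c<n eq)

  toℕ-twin₀ : toℕ twin₀ ≡ 0
  toℕ-twin₀ = Fin.toℕ-fromℕ< 0<n

  toℕ-twin₁ : toℕ twin₁ ≡ c
  toℕ-twin₁ = Fin.toℕ-fromℕ< c<n

  toℕ-junction : toℕ junction ≡ suc c
  toℕ-junction = Fin.toℕ-fromℕ< 2+c≤n

  twin₀≤c : toℕ twin₀ ≤ c
  twin₀≤c = ≤-trans (≤-reflexive toℕ-twin₀) z≤n

  twin₁≤c : toℕ twin₁ ≤ c
  twin₁≤c = ≤-reflexive toℕ-twin₁

  otherTwin : ∀ x → ∃[ y ] y ≢ x × toℕ y ≤ c
  otherTwin x with twin₀ Fin.≟ x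
  ... | yes refl = twin₁ , ≢-sym twin₀≢twin₁ , twin₁≤c
  ... | no ≢x    = twin₀ , ≢x , twin₀≤c

  height-twin : ∀ {x} → toℕ x ≤ c → height x ≡ 0
  height-twin = m≤n⇒m∸n≡0

  height-junction : height junction ≡ 1
  height-junction = trans (cong (_∸ c) toℕ-junction) (m+n∸n≡m 1 c)

  d-height : ∀ {x y} → x ≢ y → d x y ≡ 1 ⊔ ∣ height x - height y ∣
  d-height {x} {y} x≢y = trans (d≡D x y) (D-≢ x≢y)

  d-twin : ∀ {x y} → x ≢ y → toℕ y ≤ c → d x y ≡ 1 ⊔ height x
  d-twin {x} {y} x≢y y≤c = trans (d-height x≢y)
    (cong (1 ⊔_) (trans (cong (∣ height x -_∣) (height-twin y≤c)) (∣-∣-identityʳ (height x))))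

  -- Merges the two clauses of `WTR`: the weak one applies if `y ∈ W`, resolvability otherwise.
  -- Either way `w` is a third vertex, so nothing is separated merely by its distance 0 to itself.
  WTR⇒distinguishes : ∀ {W} → WTR W → ∀ {x y} → x ∉ W → x ≢ y →
                      ∃[ w ] w ∈ W × w ≢ x × w ≢ y × d x w ≢ d y w
  WTR⇒distinguishes {W} (resolving , weak) {x} {y} x∉W x≢y with y ∈? W
  ... | yes y∈W = let (w , (w∈W , w≢y) , ≢) = weak y x y∈W x∉W
                  in w , w∈W , ∈∧∉⇒≢ w∈W x∉W , w≢y , ≢
  ... | no  y∉W = let (w , w∈W , ≢) = resolving x y x≢y
                  in w , w∈W , ∈∧∉⇒≢ w∈W x∉W , ∈∧∉⇒≢ w∈W y∉W , ≢

  -- Two twins are equidistant from every third vertex, so an omitted twin could not be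
  -- distinguished from another one.
  twins⊆WTR : ∀ {W} → WTR W → ∀ {x} → toℕ x ≤ c → x ∈ W
  twins⊆WTR {W} wtr {x} x≤c with x ∈? W
  ... | yes x∈W = x∈W
  ... | no  x∉W with otherTwin x
  ... | y , y≢x , y≤c with WTR⇒distinguishes wtr x∉W (≢-sym y≢x)
  ... | w , _ , w≢x , w≢y , dxw≢dyw = contradiction (trans (d-height (≢-sym w≢x))
    (trans (cong (λ h → 1 ⊔ ∣ h - height w ∣) (trans (height-twin x≤c) (sym (height-twin y≤c))))
           (sym (d-height (≢-sym w≢y))))) dxw≢dyw

  -- The junction and `twin₀` are both at distance 1 from every other twin. If the junction is
  -- missing from `W`, the vertex telling them apart is therefore not a twin.
  nonTwin∈WTR : ∀ {W} → WTR W → ∃[ x ] x ∈ W × c < toℕ x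
  nonTwin∈WTR {W} wtr with junction ∈? W
  ... | yes junction∈W = junction , junction∈W , ≤-reflexive (sym toℕ-junction)
  ... | no  junction∉W
    with WTR⇒distinguishes wtr junction∉W
           (λ eq → 0≢1+n (trans (sym toℕ-twin₀) (trans (cong toℕ (sym eq)) toℕ-junction)))
  ... | w , w∈W , w≢junction , w≢twin₀ , ≢ with toℕ w ≤? c
  ... | no  w≰c = w , w∈W , ≰⇒> w≰c
  ... | yes w≤c = contradiction (trans (d-twin (≢-sym w≢junction) w≤c)
    (trans (cong (1 ⊔_) height-junction)
      (trans (cong (1 ⊔_) (sym (height-twin twin₀≤c))) (sym (d-twin (≢-sym w≢twin₀) w≤c))))) ≢

  2+c≤∣WTR∣ : ∀ {W} → WTR W → 2 + c ≤ ∣ W ∣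
  2+c≤∣WTR∣ {W} wtr = ≤-trans (≤-reflexive (cong suc (sym (∣firstElements∣ c<n)))) (p⊂q⇒∣p∣<∣q∣ twins⊂W)
    where
    twins⊂W : firstElements n (suc c) ⊂ W
    twins⊂W = (λ x∈ → twins⊆WTR wtr (s≤s⁻¹ (∈-firstElements⁻ x∈))) ,
      let (x , x∈W , c<x) = nonTwin∈WTR wtr
      in x , x∈W , λ x∈ → <⇒≱ c<x (s≤s⁻¹ (∈-firstElements⁻ x∈))

  -- Upper bound: the clique is a WTR-set.

  clique : Subset n
  clique = firstElements n (2 + c)

  twin∈clique : ∀ {x} → toℕ x ≤ c → x ∈ clique
  twin∈clique = ∈-firstElements⁺ ∘ m≤n⇒m≤1+n ∘ s≤s

  height-clique : ∀ {x} → x ∈ clique → height x ≤ 1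
  height-clique {x} x∈ = m≤n+o⇒m∸n≤o (toℕ x) c
    (≤-trans (s≤s⁻¹ (∈-firstElements⁻ x∈)) (≤-reflexive (+-comm 1 c)))

  ∉clique⇒2+c≤ : ∀ {x} → x ∉ clique → 2 + c ≤ toℕ x
  ∉clique⇒2+c≤ x∉ = ≮⇒≥ (x∉ ∘ ∈-firstElements⁺)

  height-path : ∀ {x} → x ∉ clique → 2 ≤ height x
  height-path x∉ = ≤-trans (≤-reflexive (sym (m+n∸n≡m 2 c))) (∸-monoˡ-≤ c (∉clique⇒2+c≤ x∉))

  d-path-twin : ∀ {x y} → x ∉ clique → toℕ y ≤ c → d x y ≡ height x
  d-path-twin x∉ y≤c = trans (d-twin (≢-sym (∈∧∉⇒≢ (twin∈clique y≤c) x∉)) y≤c)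
    (m≤n⇒m⊔n≡n (<⇒≤ (height-path x∉)))

  clique-resolving : Resolving clique
  clique-resolving y z y≢z with y ∈? clique | z ∈? clique
  ... | yes y∈ | _ = y , y∈ , λ eq → y≢z (sym (ConnectedGraph.d≡0⇒≡ G z y
          (trans (sym eq) (ConnectedGraph.d-self G y))))
  ... | no _ | yes z∈ = z , z∈ , λ eq → y≢z (ConnectedGraph.d≡0⇒≡ G y z
          (trans eq (ConnectedGraph.d-self G z)))
  -- Two path vertices are told apart by `twin₀`, since their distances to it are their heights,
  -- which are distinct.
  ... | no y∉ | no z∉ = twin₀ , twin∈clique twin₀≤c , λ eq →
    y≢z (Fin.toℕ-injective (∸-cancelʳ-≡ (c≤ y∉) (c≤ z∉)
      (trans (sym (d-path-twin y∉ twin₀≤c)) (trans eq (d-path-twin z∉ twin₀≤c)))))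
    where
    c≤ : ∀ {x} → x ∉ clique → c ≤ toℕ x
    c≤ = ≤-trans (m≤n+m c 2) ∘ ∉clique⇒2+c≤

  -- For the weak clause, a twin other than `w` is at distance 1 from `w` but at least 2 from every
  -- path vertex.
  clique-WTR : WTR clique
  clique-WTR = clique-resolving , λ w x w∈ x∉ →
    let (y , y≢w , y≤c) = otherTwin w
    in y , (twin∈clique y≤c , y≢w) , λ eq → <⇒≱ (height-path x∉)
      (≤-trans (≤-reflexive (trans (sym (d-path-twin x∉ y≤c)) (trans eq (d-twin (≢-sym y≢w) y≤c))))
               (⊔-lub ≤-refl (height-clique w∈)))

  -- The values of the two parameters.

  dimwt≡2+c : dimwt ≡ 2 + c
  dimwt≡2+c = ≤-antisym
    (Minimum.minimal dimwtMinimum (2 + c) (clique , ∣firstElements∣ 2+c≤n , clique-WTR))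
    (let (W , size , wtr) = Minimum.holds dimwtMinimum
     in ≤-trans (2+c≤∣WTR∣ wtr) (≤-reflexive size))

  reswt≡n : reswt ≡ n
  reswt≡n = ≤-antisym
    (Minimum.minimal reswtMinimum n
      (0<n , λ W size → subst WTR (sym (∣p∣≡n⇒p≡⊤ size)) ⊤-wtr))
    (≮⇒≥ reswt≮n)
    where
    -- Otherwise the complement of the first `n ∸ reswt` vertices would be a WTR-set of size
    -- `reswt`, yet it omits `twin₀`.
    reswt≮n : ¬ reswt < n
    reswt≮n r<n = x∈p⇒x∉∁p twin₀∈ (twins⊆WTR wtr twin₀≤c)
      where
      m : ℕ
      m = n ∸ reswt
      twin₀∈ : twin₀ ∈ firstElements n m
      twin₀∈ = ∈-firstElements⁺ (subst (_< m) (sym toℕ-twin₀) (m<n⇒0<n∸m r<n))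
      size : ∣ ∁ (firstElements n m) ∣ ≡ reswt
      size = trans (∣∁p∣≡n∸∣p∣ (firstElements n m))
        (trans (cong (n ∸_) (∣firstElements∣ (m∸n≤m n reswt))) (m∸[m∸n]≡n (<⇒≤ r<n)))
      wtr : WTR (∁ (firstElements n m))
      wtr = proj₂ (Minimum.holds reswtMinimum) _ size

theorem8 : ∀ (a b : ℕ) → 3 ≤ a → a ≤ b → Σ[ G ∈ ConnectedGraph ] (ConnectedGraph.dimwt G ≡ a × ConnectedGraph.reswt G ≡ b)
-- The clique has `c + 1` twins and the junction, so `a` is `2 + c`; `3 ≤ a` becomes `0 < c`, which
-- provides two distinct twins.
theorem8 (suc (suc c)) b (s≤s (s≤s 0<c)) a≤b = G , dimwt≡2+c , reswt≡n
  where open Lollipop c b 0<c a≤b
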